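{- Let $n\ge 0$ and let $A$ be a magic-faced hypercube of dimension $n$. If $n$ is even, then $A$ is automatically a magic-faced folded hypercube: when $A$ is viewed as a labeling of the vertices of $FQ_n$, the labels on every $4$-cycle of $FQ_n$ have the same sum. If $n$ is odd, then $A$ is automatically a magic-faced hierarchical folded hypercube: there is a coordinate direction $j\in\{1,\ldots,n\}$ such that, when $A$ is viewed as a labeling of the vertices of $H_jFQ_n$, the labels on every $4$-cycle of $H_jFQ_n$ have the same sum.
   Context: $Q_n$ is the hypercube graph on vertex set $\{0,1\}^n$ (two vertices adjacent iff they differ in exactly one coordinate). A magic-faced hypercube of dimension $n$ is a bijective labeling of the vertices of $Q_n$ by $1,\ldots,2^n$ such that every $4$-cycle of $Q_n$ (equivalently, every $2\times2$ face of the $2\times\cdots\times2$ array) has the same sum of labels. The folded hypercube graph $FQ_n$ is $Q_n$ together with an additional edge joining each pair of antipodal vertices (vertices differing in all $n$ coordinates); $FQ_0$ is a single vertex. For $n\ge1$ and $j\in\{1,\ldots,n\}$, the hierarchical folded hypercube graph $H_jFQ_n$ is $Q_n$ together with additional edges joining, inside each of the two copies of $Q_{n-1}$ obtained by fixing the $j$-th coordinate to be $0$ or $1$, each pair of antipodal vertices of that $Q_{n-1}$ (i.e. vertices agreeing in coordinate $j$ and differing in all other coordinates). All the $H_jFQ_n$ are isomorphic to the Cartesian product of $K_2$ with $FQ_{n-1}$. -}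

module Defs where

open import Data.Bool.Base using (Bool)
open import Data.Fin.Base using (Fin; toℕ)
open import Data.List.Base using ([]; _∷_)
open import Data.List.Relation.Unary.Unique.Propositional using (Unique)
open import Data.Nat.Base using (ℕ; suc; _+_; _^_)
open import Data.Product using (_×_; _,_; ∃!)
open import Data.Sum.Base using (_⊎_; inj₁; inj₂)
open import Data.Vec.Base using (Vec; lookup)
open import Function.Bundles using (_⤖_; Bijection)
open import Level using (0ℓ)
open import Relation.Binary.Core using (Rel)
open import Relation.Binary.Definitions using (Symmetric; Irreflexive)
open import Relation.Binary.PropositionalEquality using (_≡_; _≢_; refl; sym; ≢-sym)

record SimpleGraph (V : Set) : Set₁ where
  field
    Adj        : Rel V 0ℓ
    adj-sym    : Symmetric Adj
    adj-irrefl : Irreflexive _≡_ Adj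

open SimpleGraph

record FourCycle {V : Set} (G : SimpleGraph V) : Set where
  field
    a b c d  : V
    distinct : Unique (a ∷ b ∷ c ∷ d ∷ [])
    ab       : Adj G a b
    bc       : Adj G b c
    cd       : Adj G c d
    da       : Adj G d a

-- Only pairs of distinct vertices become edges.  This matters for the
-- antipodality relations below, which in dimension 0 relate the unique
-- vertex to itself.
addEdges : {V : Set} (G : SimpleGraph V) (R : Rel V 0ℓ) → Symmetric R → SimpleGraph V
addEdges G R R-sym = record
  { Adj        = λ x y → Adj G x y ⊎ (x ≢ y × R x y)
  ; adj-sym    = λ { (inj₁ e)         → inj₁ (adj-sym G e)
                   ; (inj₂ (x≢y , r)) → inj₂ (≢-sym x≢y , R-sym r) }
  ; adj-irrefl = λ { x≡y (inj₁ e)         → adj-irrefl G x≡y e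
                   ; x≡y (inj₂ (x≢y , _)) → x≢y x≡y }
  }

Vertex : ℕ → Set
Vertex n = Vec Bool n

Q : (n : ℕ) → SimpleGraph (Vertex n)
Q n = record
  { Adj        = λ x y → ∃! _≡_ λ i → lookup x i ≢ lookup y i
  ; adj-sym    = λ { (i , d , u) → i , ≢-sym d , λ d′ → u (≢-sym d′) }
  ; adj-irrefl = λ { refl (i , d , _) → d refl }
  }

Antipodal : {n : ℕ} → Rel (Vertex n) 0ℓ
Antipodal x y = ∀ i → lookup x i ≢ lookup y i

AntipodalInLayer : {n : ℕ} → Fin n → Rel (Vertex n) 0ℓ
AntipodalInLayer j x y =
  lookup x j ≡ lookup y j × (∀ i → i ≢ j → lookup x i ≢ lookup y i)

FQ : (n : ℕ) → SimpleGraph (Vertex n)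
FQ n = addEdges (Q n) Antipodal (λ d i → ≢-sym (d i))

HFQ : (n : ℕ) → Fin n → SimpleGraph (Vertex n)
HFQ n j = addEdges (Q n) (AntipodalInLayer j)
  (λ { (e , d) → sym e , λ i i≢j → ≢-sym (d i i≢j) })

Labeling : ℕ → Set
Labeling n = Vertex n ⤖ Fin (2 ^ n)

-- The shift by one turns {0, …, 2ⁿ − 1} into {1, …, 2ⁿ}.
label : {n : ℕ} → Labeling n → Vertex n → ℕ
label A x = suc (toℕ (Bijection.to A x))

cycleSum : {n : ℕ} {G : SimpleGraph (Vertex n)} → Labeling n → FourCycle G → ℕ
cycleSum A C = label A a + label A b + label A c + label A d
  where open FourCycle C

MagicFaced : {n : ℕ} → SimpleGraph (Vertex n) → Labeling n → Set
MagicFaced G A = (C D : FourCycle G) → cycleSum A C ≡ cycleSum A D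

{-# OPTIONS --safe #-}

-- Rescale the labels to f x = 2 L(x) − (2ⁿ + 1), which runs over a set symmetric
-- about 0.  Summing over all vertices shows that every face has f-sum 0, so that
-- h x = (−1)^|x| f x is affine in the coordinates of x.
--
-- Cube edges change the parity of |x| and antipodal edges keep it, so the new 4-cycles
-- alternate between cube edges and antipodal edges.  Their f-sum vanishes because
-- h x − h (x + eᵢ) depends only on xᵢ and changes sign with it, except, for odd n, in
-- the direction j of the layers, where h x = h (x + eⱼ) is needed.  Such a j exists: the
-- n-th mixed difference Σ (−1)^|x| (h x)ⁿ equals ± n! Πⱼ (h eⱼ − h 0), and for odd n it
-- is also Σ (f x)ⁿ, which is 0 by symmetry.
module Submission where

open import Defs
open import Algebra.Definitions using (Involutive)
open import Data.Bool.Base using (true; false; not; if_then_else_)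
open import Data.Bool.Properties using (not-involutive; not-¬; ¬-not) renaming (_≟_ to _≟ᵇ_)
open import Data.Empty using (⊥-elim)
open import Data.Fin.Base using (Fin; zero; suc; toℕ; opposite)
open import Data.Fin.Properties using (opposite-prop; opposite-involutive; toℕ<n)
  renaming (_≟_ to _≟ᶠ_)
open import Data.Integer.Base using (ℤ; +_; +0; 0ℤ; 1ℤ; -1ℤ; _+_; _*_; -_; _-_; _^_)
open import Data.Integer.Properties
  using (_≟_; neg-involutive; +-0-abelianGroup; +-injective; +-identityˡ; +-identityʳ; +-inverseʳ;
         *-identityˡ; *-zeroʳ; *-cancelˡ-≡; i*j≡0⇒i≡0∨j≡0; i-j≡0⇒i≡j)
open import Data.Integer.Tactic.RingSolver using (solve-∀)
open import Data.List.Relation.Unary.All using ([]; _∷_)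
open import Data.List.Relation.Unary.AllPairs using ([]; _∷_)
import Data.Nat.Base as ℕ
import Data.Nat.Properties as ℕ
open import Data.Nat.Base using (ℕ; zero; suc)
open import Data.Nat.Divisibility using (_∣_; _∤_; divides; ∣-refl; ∣m∣n⇒∣m+n; ∣m+n∣m⇒∣n; _∣0)
open import Data.Product.Base using (_×_; _,_; ∃-syntax)
open import Data.Sum.Base using (_⊎_; inj₁; inj₂)
open import Data.Vec.Base using ([]; _∷_; lookup; map; replicate; updateAt)
open import Data.Vec.Properties
  using (≡-dec; lookup-map; lookup∘updateAt; lookup∘updateAt′; map-updateAt; map-id; map-∘; map-cong;
         updateAt-commutes; updateAt-updateAt; updateAt-id-local)
open import Data.Vec.Relation.Binary.Pointwise.Extensional using (ext; extensional⇒inductive)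
open import Data.Vec.Relation.Binary.Pointwise.Inductive using (Pointwise-≡⇒≡)
open import Function.Base using (_∘_; const)
open import Function.Bundles using (Bijection; Inverse; mk⇔)
open import Function.Properties.Bijection using (⤖⇒↔)
open import Level using (0ℓ)
open import Relation.Binary.Core using (Rel)
open import Relation.Binary.Definitions using (Symmetric)
open import Relation.Binary.PropositionalEquality
open import Relation.Nullary.Decidable using (yes; no; does; does-⇔; dec-true; dec-false)
open import Relation.Nullary.Negation using (contradiction)
open import Algebra.Properties.AbelianGroup +-0-abelianGroup using (∙-cancelʳ)

open ≡-Reasoning

private
  variable
    n : ℕ

-- Flips, complements and the parity sign

flip : Fin n → Vertex n → Vertex n
flip i x = updateAt x i not

complement : Vertex n → Vertex n
complement = map not

vertex-ext : {x y : Vertex n} → (∀ i → lookup x i ≡ lookup y i) → x ≡ y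
vertex-ext = Pointwise-≡⇒≡ ∘ extensional⇒inductive ∘ ext

flip-involutive : (i : Fin n) → Involutive _≡_ (flip i)
flip-involutive i x =
  trans (updateAt-updateAt i x) (updateAt-id-local i x (not-involutive (lookup x i)))

flip-comm : (i k : Fin n) (x : Vertex n) → flip i (flip k x) ≡ flip k (flip i x)
flip-comm i k x with i ≟ᶠ k
... | yes refl = refl
... | no i≢k   = updateAt-commutes i k i≢k x

lookup-flip-≢ : (i : Fin n) (x : Vertex n) → lookup x i ≢ lookup (flip i x) i
lookup-flip-≢ i x e = not-¬ refl (trans e (lookup∘updateAt i x))

complement-involutive : Involutive _≡_ (complement {n})
complement-involutive x =
  trans (sym (map-∘ not not x)) (trans (map-cong not-involutive x) (map-id x))

complement-flip : (i : Fin n) (x : Vertex n) → complement (flip i x) ≡ flip i (complement x)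
complement-flip i x = map-updateAt x i refl

-- Walk from `x` to `y` changing one coordinate at a time, and only coordinates in which they
-- differ.
invariant⇒≡ : {B : Set} (g : Vertex n → B) (x y : Vertex n) →
  (∀ k → lookup x k ≢ lookup y k → ∀ z → g (flip k z) ≡ g z) → g x ≡ g y
invariant⇒≡ g [] [] inv = refl
invariant⇒≡ g (a ∷ x) (b ∷ y) inv with a ≟ᵇ b
... | yes refl = invariant⇒≡ (g ∘ (a ∷_)) x y λ k ne z → inv (suc k) ne (a ∷ z)
... | no a≢b   = begin
  g (a ∷ x)     ≡⟨ inv zero a≢b (a ∷ x) ⟨
  g (not a ∷ x) ≡⟨ cong (λ c → g (c ∷ x)) (sym (¬-not (a≢b ∘ sym))) ⟩
  g (b ∷ x)     ≡⟨ invariant⇒≡ (g ∘ (b ∷_)) x y (λ k ne z → inv (suc k) ne (b ∷ z)) ⟩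
  g (b ∷ y)     ∎

sgn : Vertex n → ℤ
sgn []          = 1ℤ
sgn (false ∷ x) = sgn x
sgn (true ∷ x)  = - sgn x

sgn-flip : (i : Fin n) (x : Vertex n) → sgn (flip i x) ≡ - sgn x
sgn-flip zero    (false ∷ x) = refl
sgn-flip zero    (true ∷ x)  = sym (neg-involutive (sgn x))
sgn-flip (suc i) (false ∷ x) = sgn-flip i x
sgn-flip (suc i) (true ∷ x)  = cong -_ (sgn-flip i x)

sgn-±1 : (x : Vertex n) → sgn x ≡ 1ℤ ⊎ sgn x ≡ -1ℤ
sgn-±1 []          = inj₁ refl
sgn-±1 (false ∷ x) = sgn-±1 x
sgn-±1 (true ∷ x) with sgn-±1 x
... | inj₁ e = inj₂ (cong -_ e)
... | inj₂ e = inj₁ (cong -_ e)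

i≡-i⇒i≡0 : ∀ {i} → i ≡ - i → i ≡ 0ℤ
i≡-i⇒i≡0 {+0} e = refl

sgn≢-sgn : (x : Vertex n) → sgn x ≢ - sgn x
sgn≢-sgn x e with sgn x | sgn-±1 x | i≡-i⇒i≡0 e
... | _ | inj₁ refl | ()
... | _ | inj₂ refl | ()

sgn-complement : (x : Vertex n) → sgn (complement x) ≡ -1ℤ ^ n * sgn x
sgn-complement [] = refl
sgn-complement {suc n} (false ∷ x) = trans (cong -_ (sgn-complement x)) (lemma (-1ℤ ^ n) (sgn x))
  where
  lemma : ∀ p s → - (p * s) ≡ -1ℤ * p * s
  lemma = solve-∀
sgn-complement {suc n} (true ∷ x) = trans (sgn-complement x) (lemma (-1ℤ ^ n) (sgn x))
  where
  lemma : ∀ p s → p * s ≡ -1ℤ * p * (- s)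
  lemma = solve-∀

-1*[-1*p]≡p : ∀ p → -1ℤ * (-1ℤ * p) ≡ p
-1*[-1*p]≡p = solve-∀

-1^even : ∀ n → 2 ∣ n → -1ℤ ^ n ≡ 1ℤ
-1^even zero          _   = refl
-1^even (suc zero)    (divides zero ())
-1^even (suc zero)    (divides (suc _) ())
-1^even (suc (suc n)) 2∣n = trans (-1*[-1*p]≡p (-1ℤ ^ n)) (-1^even n (∣m+n∣m⇒∣n 2∣n ∣-refl))

-1^odd : ∀ n → 2 ∤ n → -1ℤ ^ n ≡ -1ℤ
-1^odd zero          2∤n = contradiction (2 ∣0) 2∤n
-1^odd (suc zero)    _   = refl
-1^odd (suc (suc n)) 2∤n = trans (-1*[-1*p]≡p (-1ℤ ^ n)) (-1^odd n (2∤n ∘ ∣m∣n⇒∣m+n ∣-refl))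

neg-^ : ∀ t n → (- t) ^ n ≡ -1ℤ ^ n * t ^ n
neg-^ t zero    = refl
neg-^ t (suc n) = trans (cong (- t *_) (neg-^ t n)) (lemma t (-1ℤ ^ n) (t ^ n))
  where
  lemma : ∀ t p q → - t * (p * q) ≡ -1ℤ * p * (t * q)
  lemma = solve-∀

neg-^-odd : 2 ∤ n → ∀ t → (- t) ^ n ≡ - (t ^ n)
neg-^-odd {n} 2∤n t =
  trans (neg-^ t n) (trans (cong (_* t ^ n) (-1^odd n 2∤n)) (lemma (t ^ n)))
  where
  lemma : ∀ p → -1ℤ * p ≡ - p
  lemma = solve-∀

-- Sums over the vertices of the cube

∑ : (Vertex n → ℤ) → ℤ
∑ {zero}  F = F []
∑ {suc n} F = ∑ (F ∘ (false ∷_)) + ∑ (F ∘ (true ∷_))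

∑-cong : {F G : Vertex n → ℤ} → (∀ x → F x ≡ G x) → ∑ F ≡ ∑ G
∑-cong {zero}  e = e []
∑-cong {suc n} e = cong₂ _+_ (∑-cong {n} (e ∘ (false ∷_))) (∑-cong {n} (e ∘ (true ∷_)))

∑-+ : (F G : Vertex n → ℤ) → ∑ F + ∑ G ≡ ∑ (λ x → F x + G x)
∑-+ {zero}  F G = refl
∑-+ {suc n} F G = trans (lemma (∑ F₀) (∑ F₁) (∑ G₀) (∑ G₁)) (cong₂ _+_ (∑-+ F₀ G₀) (∑-+ F₁ G₁))
  where
  F₀ F₁ G₀ G₁ : Vertex n → ℤ
  F₀ = F ∘ (false ∷_)
  F₁ = F ∘ (true ∷_)
  G₀ = G ∘ (false ∷_)
  G₁ = G ∘ (true ∷_)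
  lemma : ∀ a b c d → a + b + (c + d) ≡ a + c + (b + d)
  lemma = solve-∀

∑-neg : (F : Vertex n → ℤ) → ∑ (λ x → - F x) ≡ - ∑ F
∑-neg {zero}  F = refl
∑-neg {suc n} F = trans (cong₂ _+_ (∑-neg F₀) (∑-neg F₁)) (lemma (∑ F₀) (∑ F₁))
  where
  F₀ F₁ : Vertex n → ℤ
  F₀ = F ∘ (false ∷_)
  F₁ = F ∘ (true ∷_)
  lemma : ∀ a b → - a + - b ≡ - (a + b)
  lemma = solve-∀

∑-zero : ∀ n → ∑ {n} (λ _ → 0ℤ) ≡ 0ℤ
∑-zero zero    = refl
∑-zero (suc n) = cong₂ _+_ (∑-zero n) (∑-zero n)

-- The sum is 2ⁿ `c`; the induction cancels one factor 2 per coordinate.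
∑-const≡0 : ∀ n {c} → ∑ {n} (const c) ≡ 0ℤ → c ≡ 0ℤ
∑-const≡0 zero    e = e
∑-const≡0 (suc n) e = ∑-const≡0 n (*-cancelˡ-≡ (+ 2) _ 0ℤ (trans (lemma (∑ {n} (const _))) e))
  where
  lemma : ∀ s → + 2 * s ≡ s + s
  lemma = solve-∀

∑-swap : ∀ {m n} (F : Vertex m → Vertex n → ℤ) →
  ∑ (λ x → ∑ (λ y → F x y)) ≡ ∑ (λ y → ∑ (λ x → F x y))
∑-swap {zero}  F = refl
∑-swap {suc m} {n} F = trans
  (cong₂ _+_ (∑-swap (F ∘ (false ∷_))) (∑-swap (F ∘ (true ∷_))))
  (∑-+ {n} (λ y → ∑ (λ x → F (false ∷ x) y)) (λ y → ∑ (λ x → F (true ∷ x) y)))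

∑-single : (z : Vertex n) (F : Vertex n → ℤ) → (∀ y → y ≢ z → F y ≡ 0ℤ) → ∑ F ≡ F z
∑-single []          F vanish = refl
∑-single {suc n} (false ∷ z) F vanish = begin
  ∑ (F ∘ (false ∷_)) + ∑ (F ∘ (true ∷_))
    ≡⟨ cong₂ _+_ (∑-single z (F ∘ (false ∷_)) λ y y≢z → vanish (false ∷ y) λ { refl → y≢z refl })
                 (trans (∑-cong λ y → vanish (true ∷ y) λ ()) (∑-zero n)) ⟩
  F (false ∷ z) + 0ℤ
    ≡⟨ +-identityʳ _ ⟩
  F (false ∷ z) ∎
∑-single {suc n} (true ∷ z)  F vanish = begin
  ∑ (F ∘ (false ∷_)) + ∑ (F ∘ (true ∷_))
    ≡⟨ cong₂ _+_ (trans (∑-cong λ y → vanish (false ∷ y) λ ()) (∑-zero n))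
                 (∑-single z (F ∘ (true ∷_)) λ y y≢z → vanish (true ∷ y) λ { refl → y≢z refl }) ⟩
  0ℤ + F (true ∷ z)
    ≡⟨ +-identityˡ _ ⟩
  F (true ∷ z) ∎

δ : Vertex n → Vertex n → ℤ
δ x y = if does (≡-dec _≟ᵇ_ x y) then 1ℤ else 0ℤ

∑-δ : (z : Vertex n) (F : Vertex n → ℤ) → ∑ (λ y → δ y z * F y) ≡ F z
∑-δ z F = trans (∑-single z _ off) on
  where
  off : ∀ y → y ≢ z → δ y z * F y ≡ 0ℤ
  off y y≢z rewrite dec-false (≡-dec _≟ᵇ_ y z) y≢z = refl
  on : δ z z * F z ≡ F z
  on rewrite dec-true (≡-dec _≟ᵇ_ z z) refl = *-identityˡ (F z)

-- The recursion of `∑` splits off coordinates, which `σ` need not respect. So `F (σ x)` is expanded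
-- against `δ`, the sums are exchanged, and the indicator of `y ≡ σ x` is read as that of `x ≡ σ y`.
∑-involution : {σ : Vertex n → Vertex n} → Involutive _≡_ σ →
  (F : Vertex n → ℤ) → ∑ (F ∘ σ) ≡ ∑ F
∑-involution {σ = σ} inv F = begin
  ∑ (λ x → F (σ x))                     ≡⟨ ∑-cong (λ x → ∑-δ (σ x) F) ⟨
  ∑ (λ x → ∑ (λ y → δ y (σ x) * F y))   ≡⟨ ∑-swap (λ x y → δ y (σ x) * F y) ⟩
  ∑ (λ y → ∑ (λ x → δ y (σ x) * F y))   ≡⟨ ∑-cong (λ y → ∑-cong λ x → cong (_* F y) (δ-σ x y)) ⟩
  ∑ (λ y → ∑ (λ x → δ x (σ y) * F y))   ≡⟨ ∑-cong (λ y → ∑-δ (σ y) (const (F y))) ⟩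
  ∑ F                                   ∎
  where
  transpose : ∀ {x y} → y ≡ σ x → x ≡ σ y
  transpose {x} refl = sym (inv x)
  δ-σ : ∀ x y → δ y (σ x) ≡ δ x (σ y)
  δ-σ x y = cong (if_then 1ℤ else 0ℤ)
    (does-⇔ (mk⇔ transpose transpose) (≡-dec _≟ᵇ_ y (σ x)) (≡-dec _≟ᵇ_ x (σ y)))

∑-antisymmetric : {σ : Vertex n → Vertex n} → Involutive _≡_ σ →
  {F : Vertex n → ℤ} → (∀ x → F (σ x) ≡ - F x) → ∑ F ≡ 0ℤ
∑-antisymmetric inv {F} anti =
  i≡-i⇒i≡0 (trans (sym (∑-involution inv F)) (trans (∑-cong anti) (∑-neg F)))

-- Finite differences

-- P is a polynomial function with k-th coefficient c and no higher terms, expressed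
-- by the fact that differencing by d lowers the degree k and multiplies c by k d.
data Lead : ℕ → ℤ → (ℤ → ℤ) → Set where
  constant   : ∀ {c P} → (∀ t → P t ≡ c) → Lead zero c P
  difference : ∀ {k c P} → (∀ d → Lead k (+ suc k * c * d) (λ t → P (t + d) - P t)) →
               Lead (suc k) c P

Lead-cong : ∀ {k c c′ P P′} → c ≡ c′ → (∀ t → P t ≡ P′ t) → Lead k c P → Lead k c′ P′
Lead-cong refl e (constant L)   = constant λ t → trans (sym (e t)) (L t)
Lead-cong refl e (difference L) =
  difference λ d → Lead-cong refl (λ t → cong₂ _-_ (e (t + d)) (e t)) (L d)

Lead-+ : ∀ {k c c′ P P′} → Lead k c P → Lead k c′ P′ → Lead k (c + c′) (λ t → P t + P′ t)
Lead-+ (constant L) (constant L′) = constant λ t → cong₂ _+_ (L t) (L′ t)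
Lead-+ {suc k} {c} {c′} {P} {P′} (difference L) (difference L′) = difference λ d →
  Lead-cong (coeff (+ suc k) c c′ d) (λ t → values (P (t + d)) (P t) (P′ (t + d)) (P′ t))
    (Lead-+ (L d) (L′ d))
  where
  coeff : ∀ s c c′ d → s * c * d + s * c′ * d ≡ s * (c + c′) * d
  coeff = solve-∀
  values : ∀ p q p′ q′ → p - q + (p′ - q′) ≡ p + p′ - (q + q′)
  values = solve-∀

Lead-scale : ∀ {k c P} e → Lead k c P → Lead k (e * c) (λ t → e * P t)
Lead-scale e (constant L) = constant λ t → cong (e *_) (L t)
Lead-scale {suc k} {c} {P} e (difference L) = difference λ d →
  Lead-cong (coeff (+ suc k) c d e) (λ t → values e (P (t + d)) (P t)) (Lead-scale e (L d))
  where
  coeff : ∀ s c d e → e * (s * c * d) ≡ s * (e * c) * d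
  coeff = solve-∀
  values : ∀ e p q → e * (p - q) ≡ e * p - e * q
  values = solve-∀

Lead-shift : ∀ {k c P} e → Lead k c P → Lead k c (λ t → P (t + e))
Lead-shift e (constant L) = constant λ t → L (t + e)
Lead-shift {P = P} e (difference L) = difference λ d →
  Lead-cong refl (λ t → cong (λ u → P u - P (t + e)) (lemma t e d)) (Lead-shift e (L d))
  where
  lemma : ∀ t e d → t + e + d ≡ t + d + e
  lemma = solve-∀

-- The product rule: differencing `t * P t` by `d` gives `t * (P (t + d) - P t) + d * P (t + d)`.
-- For `P` of degree k + 1 both terms have degree k + 1, with coefficients (k + 1) c d and d c,
-- which add up to (k + 2) c d.
Lead-t* : ∀ {k c P} → Lead k c P → Lead (suc k) c (λ t → t * P t)
Lead-t* {c = c} (constant L) = difference λ d → constant λ t →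
  trans (cong₂ (λ p q → (t + d) * p - t * q) (L (t + d)) (L t)) (lemma t d c)
  where
  lemma : ∀ t d c → (t + d) * c - t * c ≡ 1ℤ * c * d
  lemma = solve-∀
Lead-t* {suc k} {c} {P} L@(difference Δ) = difference λ d →
  Lead-cong (coeff (+ suc k) c d) (λ t → values t d (P (t + d)) (P t))
    (Lead-+ (Lead-t* (Δ d)) (Lead-scale d (Lead-shift d L)))
  where
  coeff : ∀ s c d → s * c * d + d * c ≡ (1ℤ + s) * c * d
  coeff = solve-∀
  values : ∀ t d p q → t * (p - q) + d * p ≡ (t + d) * p - t * q
  values = solve-∀

Lead-^ : ∀ k → Lead k 1ℤ (_^ k)
Lead-^ zero    = constant λ _ → refl
Lead-^ (suc k) = Lead-t* (Lead-^ k)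

-- Affine and balanced functions on the cube

-- Vanishing of all mixed second differences, which characterises the functions affine in the 0/1
-- coordinates.
Affine : (Vertex n → ℤ) → Set
Affine h = ∀ i k → i ≢ k → ∀ x → h x + h (flip i (flip k x)) ≡ h (flip i x) + h (flip k x)

slope : (Vertex n → ℤ) → Fin n → Vertex n → ℤ
slope h i x = h x - h (flip i x)

-- Affinity says that flipping a coordinate `k ≢ i` leaves the slope in direction `i` unchanged, and
-- the coordinates where `x` and `y` differ are all of this kind.
slope-cong : (h : Vertex n → ℤ) → Affine h → ∀ i x y → lookup x i ≡ lookup y i →
  slope h i x ≡ slope h i y
slope-cong h affine i x y e = invariant⇒≡ (slope h i) x y λ k ne z →
  lemma {a = h z} {h (flip i z)} {h (flip k z)} {h (flip i (flip k z))}
    (affine i k (λ { refl → ne e }) z)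
  where
  rearrange : ∀ a b c d → c - d ≡ b + c - (a + d) + (a - b)
  rearrange = solve-∀
  cancel : ∀ p a b → p - p + (a - b) ≡ a - b
  cancel = solve-∀
  lemma : ∀ {a b c d} → a + d ≡ b + c → c - d ≡ a - b
  lemma {a} {b} {c} {d} eq = begin
    c - d                         ≡⟨ rearrange a b c d ⟩
    b + c - (a + d) + (a - b)     ≡⟨ cong (λ p → b + c - p + (a - b)) eq ⟩
    b + c - (b + c) + (a - b)     ≡⟨ cancel (b + c) a b ⟩
    a - b                         ∎

slope-flip : (h : Vertex n → ℤ) (i : Fin n) (x : Vertex n) → slope h i (flip i x) ≡ - slope h i x
slope-flip h i x rewrite flip-involutive i x = lemma (h x) (h (flip i x))
  where
  lemma : ∀ a b → b - a ≡ - (a - b)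
  lemma = solve-∀

-- Each coordinate turns the signed sum into that of a difference of P, so the sum is
-- ± c n! times the product of all slopes.
flat-direction : ∀ n {c P} {h : Vertex n → ℤ} → Lead n c P → c ≢ 0ℤ → Affine h →
  ∑ (λ x → sgn x * P (h x)) ≡ 0ℤ → ∃[ i ] ∀ x → h (flip i x) ≡ h x
flat-direction zero {h = h} (constant L) c≢0 affine sum≡0 =
  contradiction (trans (sym (L (h []))) (trans (sym (*-identityˡ _)) sum≡0)) c≢0
flat-direction (suc n) {c} {P} {h} (difference L) c≢0 affine sum≡0 = go (d ≟ 0ℤ)
  where
  d : ℤ
  -- By `slope-cong` the other coordinates of the base point are immaterial: `d` is the step of `h`
  -- from the lower facet to the upper one everywhere.
  d = slope h zero (true ∷ replicate n false)

  step : ∀ x → h (true ∷ x) ≡ h (false ∷ x) + d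
  step x = trans (lemma (h (true ∷ x)) (h (false ∷ x)))
    (cong (_+_ (h (false ∷ x))) (slope-cong h affine zero (true ∷ x) _ refl))
    where
    lemma : ∀ a b → a ≡ b + (a - b)
    lemma = solve-∀

  -- The sign is reversed on the upper facet, so the given sum is minus the signed sum of the
  -- `d`-difference of `P` over the lower facet.
  sumΔ≡0 : ∑ (λ x → sgn x * (P (h (false ∷ x) + d) - P (h (false ∷ x)))) ≡ 0ℤ
  sumΔ≡0 = begin
    ∑ F                                       ≡⟨ +-identityʳ (∑ F) ⟨
    ∑ F + 0ℤ                                  ≡⟨ cong (_+_ (∑ F)) sum≡0 ⟨
    ∑ F + (∑ G₀ + ∑ G₁)                       ≡⟨ cong (_+_ (∑ F)) (∑-+ G₀ G₁) ⟩
    ∑ F + ∑ (λ x → G₀ x + G₁ x)               ≡⟨ ∑-+ F (λ x → G₀ x + G₁ x) ⟩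
    ∑ (λ x → F x + (G₀ x + G₁ x))             ≡⟨ ∑-cong cancels ⟩
    ∑ {n} (const 0ℤ)                          ≡⟨ ∑-zero n ⟩
    0ℤ                                        ∎
    where
    F G₀ G₁ : Vertex n → ℤ
    F x = sgn x * (P (h (false ∷ x) + d) - P (h (false ∷ x)))
    G₀ x = sgn x * P (h (false ∷ x))
    G₁ x = - sgn x * P (h (true ∷ x))
    lemma : ∀ s p q → s * (p - q) + (s * q + - s * p) ≡ 0ℤ
    lemma = solve-∀
    cancels : ∀ x → F x + (G₀ x + G₁ x) ≡ 0ℤ
    cancels x rewrite step x = lemma (sgn x) (P (h (false ∷ x) + d)) (P (h (false ∷ x)))

  nonzero : d ≢ 0ℤ → + suc n * c * d ≢ 0ℤ
  nonzero d≢0 e with i*j≡0⇒i≡0∨j≡0 (+ suc n * c) e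
  ... | inj₂ d≡0 = d≢0 d≡0
  ... | inj₁ e′ with i*j≡0⇒i≡0∨j≡0 (+ suc n) e′
  ... | inj₂ c≡0 = c≢0 c≡0

  go : _ → ∃[ i ] ∀ x → h (flip i x) ≡ h x
  go (yes d≡0) = zero , λ
    { (false ∷ x) → level x
    ; (true ∷ x)  → sym (level x) }
    where
    level : ∀ x → h (true ∷ x) ≡ h (false ∷ x)
    level x = trans (step x) (trans (cong (_+_ (h (false ∷ x))) d≡0) (+-identityʳ _))
  -- The lower facet satisfies the hypotheses for the difference of `P` by `d`, whose coefficient is
  -- nonzero. A direction flat there is flat on the upper facet too, where `h` is shifted by `d`.
  go (no d≢0) with flat-direction n (L d) (nonzero d≢0)
                     (λ i k i≢k x → affine (suc i) (suc k) (λ { refl → i≢k refl }) (false ∷ x)) sumΔ≡0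
  ... | i , flat = suc i , λ
    { (false ∷ x) → flat x
    ; (true ∷ x)  → trans (step (flip i x)) (trans (cong (_+ d) (flat x)) (sym (step x))) }

Balanced : (Vertex n → ℤ) → Set
Balanced f = ∀ i k → i ≢ k → ∀ x →
  f x + f (flip i x) + f (flip i (flip k x)) + f (flip k x) ≡ 0ℤ

twist : (Vertex n → ℤ) → Vertex n → ℤ
twist f x = sgn x * f x

twist-involutive : (f : Vertex n → ℤ) (x : Vertex n) → twist (twist f) x ≡ f x
twist-involutive f x with sgn x | sgn-±1 x
... | _ | inj₁ refl = lemma (f x)
  where
  lemma : ∀ p → 1ℤ * (1ℤ * p) ≡ p
  lemma = solve-∀
... | _ | inj₂ refl = -1*[-1*p]≡p (f x)

-- The signs alternate around a face, so the two sides of the affine identity differ by `sgn x`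
-- times the face sum of `f`.
twist-affine : (f : Vertex n → ℤ) → Balanced f → Affine (twist f)
twist-affine f balanced i k i≢k x
  rewrite sgn-flip i (flip k x) | sgn-flip i x | sgn-flip k x =
  i-j≡0⇒i≡j _ _ (trans (lemma (sgn x) (f x) (f (flip i x)) (f (flip i (flip k x))) (f (flip k x)))
    (trans (cong (sgn x *_) (balanced i k i≢k x)) (*-zeroʳ (sgn x))))
  where
  lemma : ∀ s a b d c → s * a + - - s * d - (- s * b + - s * c) ≡ s * (a + b + d + c)
  lemma = solve-∀

twist-^-odd : 2 ∤ n → (h : Vertex n → ℤ) (x : Vertex n) → twist h x ^ n ≡ sgn x * h x ^ n
twist-^-odd {n} 2∤n h x with sgn x | sgn-±1 x
... | _ | inj₁ refl = trans (cong (_^ n) (*-identityˡ (h x))) (sym (*-identityˡ _))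
... | _ | inj₂ refl = trans (cong (_^ n) (lemma (h x)))
                        (trans (neg-^-odd 2∤n (h x)) (sym (lemma (h x ^ n))))
  where
  lemma : ∀ p → -1ℤ * p ≡ - p
  lemma = solve-∀

-- A cube edge in direction `i` has sum `sgn x * slope h i x`. Its image under `τ` has the same sign
-- and the negated slope, either because `τ` reverses coordinate `i`, on which alone the slope
-- depends, or because the slope is 0.
reflected-pair-sum : (f : Vertex n → ℤ) (τ : Vertex n → Vertex n) →
  Balanced f → (∀ x → sgn (τ x) ≡ sgn x) →
  ∀ i → (∀ x → τ (flip i x) ≡ flip i (τ x)) →
  (∀ x → lookup (τ x) i ≡ not (lookup x i)) ⊎ (∀ x → twist f (flip i x) ≡ twist f x) →
  ∀ x → f x + f (flip i x) + f (τ x) + f (τ (flip i x)) ≡ 0ℤ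
reflected-pair-sum f τ balanced sgn-τ i commutes cases x = begin
  f x + f (flip i x) + f (τ x) + f (τ (flip i x))
    ≡⟨ cong (λ y → f x + f (flip i x) + f (τ x) + f y) (commutes x) ⟩
  f x + f (flip i x) + f (τ x) + f (flip i (τ x))
    ≡⟨ regroup (f x) _ _ _ ⟩
  (f x + f (flip i x)) + (f (τ x) + f (flip i (τ x)))
    ≡⟨ cong₂ _+_ (pair x) (pair (τ x)) ⟩
  sgn x * slope h i x + sgn (τ x) * slope h i (τ x)
    ≡⟨ cong₂ (λ s d → sgn x * slope h i x + s * d) (sgn-τ x) (slope-τ cases) ⟩
  sgn x * slope h i x + sgn x * - slope h i x
    ≡⟨ cancel (sgn x) (slope h i x) ⟩
  0ℤ ∎
  where
  h = twist f

  regroup : ∀ a b c d → a + b + c + d ≡ (a + b) + (c + d)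
  regroup = solve-∀
  cancel : ∀ s p → s * p + s * - p ≡ 0ℤ
  cancel = solve-∀
  expand : ∀ s p q → s * p + - s * q ≡ s * (p - q)
  expand = solve-∀

  pair : ∀ y → f y + f (flip i y) ≡ sgn y * slope h i y
  pair y = begin
    f y + f (flip i y)
      ≡⟨ cong₂ _+_ (twist-involutive f y) (twist-involutive f (flip i y)) ⟨
    sgn y * h y + sgn (flip i y) * h (flip i y)
      ≡⟨ cong (λ s → sgn y * h y + s * h (flip i y)) (sgn-flip i y) ⟩
    sgn y * h y + - sgn y * h (flip i y)
      ≡⟨ expand (sgn y) (h y) (h (flip i y)) ⟩
    sgn y * slope h i y ∎

  slope-τ : _ → slope h i (τ x) ≡ - slope h i x
  slope-τ (inj₁ opp) = trans
    (slope-cong h (twist-affine f balanced) i (τ x) (flip i x)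
      (trans (opp x) (sym (lookup∘updateAt i x))))
    (slope-flip h i x)
  slope-τ (inj₂ flat) = trans (level (τ x)) (sym (cong -_ (level x)))
    where
    level : ∀ y → slope h i y ≡ 0ℤ
    level y rewrite flat y = +-inverseʳ (h y)

-- Four-cycles

total : (Vertex n → ℤ) → {G : SimpleGraph (Vertex n)} → FourCycle G → ℤ
total f C = f a + f b + f c + f d
  where open FourCycle C

Q-edge⇒flip : (x y : Vertex n) → SimpleGraph.Adj (Q n) x y → ∃[ i ] y ≡ flip i x
Q-edge⇒flip x y (i , x≢y , unique) = i , vertex-ext same
  where
  same : ∀ k → lookup y k ≡ lookup (flip i x) k
  same k with k ≟ᶠ i
  ... | yes refl = trans (¬-not (x≢y ∘ sym)) (sym (lookup∘updateAt k x))
  ... | no k≢i with lookup x k ≟ᵇ lookup y k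
  ... | yes e = trans (sym e) (sym (lookup∘updateAt′ k i k≢i x))
  ... | no ne = contradiction (sym (unique ne)) k≢i

flip⇒Q-edge : (i : Fin n) (x : Vertex n) → SimpleGraph.Adj (Q n) x (flip i x)
flip⇒Q-edge i x = i , lookup-flip-≢ i x , unique
  where
  unique : ∀ {k} → lookup x k ≢ lookup (flip i x) k → i ≡ k
  unique {k} ne with i ≟ᶠ k
  ... | yes i≡k = i≡k
  ... | no i≢k  = contradiction (sym (lookup∘updateAt′ k i (i≢k ∘ sym) x)) ne

-- The corners are listed in the order of `Balanced`, so `total f` of a face unfolds to the sum
-- there.
face : {i k : Fin n} → i ≢ k → Vertex n → FourCycle (Q n)
face {n} {i} {k} i≢k x = record
  { a = x ; b = flip i x ; c = flip i (flip k x) ; d = flip k x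
  ; distinct = (irr ab ∷ differ i lookup-c ∷ (irr da ∘ sym) ∷ [])
             ∷ (irr bc ∷ differ′ ∷ []) ∷ (irr cd ∷ []) ∷ [] ∷ []
  ; ab = ab ; bc = bc ; cd = cd ; da = da }
  where
  open SimpleGraph (Q n)
  ab : Adj x (flip i x)
  ab = flip⇒Q-edge i x
  bc : Adj (flip i x) (flip i (flip k x))
  bc = subst (Adj (flip i x)) (flip-comm k i x) (flip⇒Q-edge k (flip i x))
  cd : Adj (flip i (flip k x)) (flip k x)
  cd = adj-sym {flip k x} {flip i (flip k x)} (flip⇒Q-edge i (flip k x))
  da : Adj (flip k x) x
  da = adj-sym {x} {flip k x} (flip⇒Q-edge k x)
  irr : ∀ {u v} → Adj u v → u ≢ v
  irr e u≡v = adj-irrefl u≡v e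
  differ : ∀ {u v} j → lookup v j ≡ not (lookup u j) → u ≢ v
  differ j e refl = not-¬ refl e
  lookup-d : lookup (flip k x) i ≡ lookup x i
  lookup-d = lookup∘updateAt′ i k i≢k x
  lookup-c : lookup (flip i (flip k x)) i ≡ not (lookup x i)
  lookup-c = trans (lookup∘updateAt i (flip k x)) (cong not lookup-d)
  differ′ : flip i x ≢ flip k x
  differ′ e = lookup-flip-≢ i x (trans (sym lookup-d) (cong (λ y → lookup y i) (sym e)))

Vertex₁-pigeonhole : {A : Set} {x y z : Vertex 1} → x ≢ y → x ≢ z → y ≢ z → A
Vertex₁-pigeonhole {x = a ∷ []} {b ∷ []} {c ∷ []} x≢y x≢z y≢z =
  contradiction (cong (_∷ []) (trans a≡¬b (sym c≡¬b))) x≢z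
  where
  a≡¬b : a ≡ not b
  a≡¬b = ¬-not (x≢y ∘ cong (_∷ []))
  c≡¬b : c ≡ not b
  c≡¬b = ¬-not (y≢z ∘ sym ∘ cong (_∷ []))

FourCycle⇒2≤n : {G : SimpleGraph (Vertex n)} → FourCycle G → 2 ℕ.≤ n
FourCycle⇒2≤n {zero} record { a = [] ; b = [] ; distinct = (a≢b ∷ _) ∷ _ } = contradiction refl a≢b
FourCycle⇒2≤n {suc zero} record { distinct = (a≢b ∷ a≢c ∷ _) ∷ (b≢c ∷ _) ∷ _ } =
  Vertex₁-pigeonhole a≢b a≢c b≢c
FourCycle⇒2≤n {suc (suc n)} C = ℕ.s≤s (ℕ.s≤s ℕ.z≤n)

-- Four-cycles after adding the edges of a parity-preserving involution

module _ {R : Rel (Vertex n) 0ℓ} (R-sym : Symmetric R)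
         (τ : Vertex n → Vertex n) (τ-involutive : Involutive _≡_ τ) (sgn-τ : ∀ x → sgn (τ x) ≡ sgn x)
         (R⇒τ : ∀ {x y} → R x y → y ≡ τ x)
         (f : Vertex n → ℤ) (Q-total : (C : FourCycle (Q n)) → total f C ≡ 0ℤ)
         (τ-total : ∀ i x → f x + f (flip i x) + f (τ x) + f (τ (flip i x)) ≡ 0ℤ)
  where

  private
    G : SimpleGraph (Vertex n)
    G = addEdges (Q n) R R-sym
    open SimpleGraph G

    -- Taking the edge itself as argument lets the sign change around a cycle compute once the kinds
    -- of its four edges are matched.
    edge-sign : ∀ {x y} → Adj x y → ℤ → ℤ
    edge-sign (inj₁ _) s = - s
    edge-sign (inj₂ _) s = s

    sgn-edge : ∀ {x y} (e : Adj x y) → sgn x ≡ edge-sign e (sgn y)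
    sgn-edge {x} {y} (inj₁ e) with Q-edge⇒flip x y e
    ... | i , refl = trans (sym (neg-involutive (sgn x))) (cong -_ (sym (sgn-flip i x)))
    sgn-edge {x} (inj₂ (_ , r)) with R⇒τ r
    ... | refl = sym (sgn-τ x)

    -- Two consecutive `τ`-edges lead back to the start, as `τ` is an involution.
    τ-path : ∀ {x y z} {A : Set} → R x y → R y z → x ≢ z → A
    τ-path {x} xy yz x≢z =
      contradiction (sym (trans (R⇒τ yz) (trans (cong τ (R⇒τ xy)) (τ-involutive x)))) x≢z

    mixed : ∀ {x y z w} → SimpleGraph.Adj (Q n) x y → R x z → R y w →
      f x + f y + f z + f w ≡ 0ℤ
    mixed {x} {y} xy xz yw with Q-edge⇒flip x y xy | R⇒τ xz | R⇒τ yw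
    ... | i , refl | refl | refl = τ-total i x

  -- Consecutive `τ`-edges are ruled out by `τ-path`, and a single `τ`-edge by parity, as three cube
  -- edges reverse the sign. There remain the cycles of `Q n` and those with two opposite `τ`-edges,
  -- covered by `mixed`.
  addEdges-total : (C : FourCycle G) → total f C ≡ 0ℤ
  addEdges-total record { a = a ; b = b ; c = c ; d = d ; ab = ab ; bc = bc ; cd = cd ; da = da
                        ; distinct = distinct@((_ ∷ a≢c ∷ _) ∷ (_ ∷ b≢d ∷ _) ∷ _) } =
    go ab bc cd da
      (trans (sgn-edge ab) (cong (edge-sign ab) (trans (sgn-edge bc) (cong (edge-sign bc)
        (trans (sgn-edge cd) (cong (edge-sign cd) (sgn-edge da)))))))
    where
    odd : ∀ {A : Set} → sgn a ≡ - sgn a → A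
    odd e = contradiction e (sgn≢-sgn a)
    odd³ : ∀ {A : Set} → sgn a ≡ - - - sgn a → A
    odd³ e = odd (trans e (neg-involutive (- sgn a)))
    swap₁ : ∀ p q r s → p + q + r + s ≡ p + q + s + r
    swap₁ = solve-∀
    swap₂ : ∀ p q r s → p + q + r + s ≡ q + r + p + s
    swap₂ = solve-∀
    go : ∀ (ab : Adj a b) (bc : Adj b c) (cd : Adj c d) (da : Adj d a) →
      sgn a ≡ edge-sign ab (edge-sign bc (edge-sign cd (edge-sign da (sgn a)))) →
      f a + f b + f c + f d ≡ 0ℤ
    go (inj₁ ab) (inj₁ bc) (inj₁ cd) (inj₁ da) _ = Q-total record
      { distinct = distinct ; ab = ab ; bc = bc ; cd = cd ; da = da }
    go (inj₁ ab) (inj₂ (_ , bc)) (inj₁ cd) (inj₂ (_ , da)) _ =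
      trans (swap₁ (f a) (f b) (f c) (f d)) (mixed ab (R-sym da) bc)
    go (inj₂ (_ , ab)) (inj₁ bc) (inj₂ (_ , cd)) (inj₁ da) _ =
      trans (swap₂ (f a) (f b) (f c) (f d)) (mixed bc (R-sym ab) cd)
    go (inj₂ (_ , ab)) (inj₂ (_ , bc)) _ _ _ = τ-path ab bc a≢c
    go _ (inj₂ (_ , bc)) (inj₂ (_ , cd)) _ _ = τ-path bc cd b≢d
    go _ _ (inj₂ (_ , cd)) (inj₂ (_ , da)) _ = τ-path cd da (a≢c ∘ sym)
    go (inj₂ (_ , ab)) _ _ (inj₂ (_ , da)) _ = τ-path da ab (b≢d ∘ sym)
    go (inj₂ _) (inj₁ _) (inj₁ _) (inj₁ _) e = odd³ e
    go (inj₁ _) (inj₂ _) (inj₁ _) (inj₁ _) e = odd³ e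
    go (inj₁ _) (inj₁ _) (inj₂ _) (inj₁ _) e = odd³ e
    go (inj₁ _) (inj₁ _) (inj₁ _) (inj₂ _) e = odd³ e

-- Labelings

-- As `opposite t` is 2ⁿ - 1 - t, this is 2 L - (2ⁿ + 1) for the label L = t + 1; written as a
-- difference, it visibly changes sign under `opposite`.
deviation : Labeling n → Vertex n → ℤ
deviation A x = + toℕ (Bijection.to A x) - + toℕ (opposite (Bijection.to A x))

deviation-label : (A : Labeling n) (x : Vertex n) →
  deviation A x ≡ + 2 * + label A x - + suc (2 ℕ.^ n)
deviation-label {n} A x = begin
  + toℕ t - + toℕ (opposite t)
    ≡⟨ lemma (+ toℕ t) (+ toℕ (opposite t)) ⟩
  + 2 * (1ℤ + + toℕ t) - (1ℤ + (1ℤ + + toℕ t + + toℕ (opposite t)))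
    ≡⟨ cong (λ s → + 2 * + label A x - + suc s) t+opposite ⟩
  + 2 * + label A x - + suc (2 ℕ.^ n) ∎
  where
  t = Bijection.to A x
  lemma : ∀ p q → p - q ≡ + 2 * (1ℤ + p) - (1ℤ + (1ℤ + p + q))
  lemma = solve-∀
  t+opposite : suc (toℕ t) ℕ.+ toℕ (opposite t) ≡ 2 ℕ.^ n
  t+opposite = trans (cong (suc (toℕ t) ℕ.+_) (opposite-prop t)) (ℕ.m+[n∸m]≡n (toℕ<n t))

total-deviation : (A : Labeling n) {G : SimpleGraph (Vertex n)} (C : FourCycle G) →
  total (deviation A) C ≡ + 2 * + cycleSum A C - + 4 * + suc (2 ℕ.^ n)
total-deviation {n} A C
  rewrite deviation-label A (FourCycle.a C) | deviation-label A (FourCycle.b C)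
        | deviation-label A (FourCycle.c C) | deviation-label A (FourCycle.d C) =
  lemma (+ label A (FourCycle.a C)) (+ label A (FourCycle.b C))
        (+ label A (FourCycle.c C)) (+ label A (FourCycle.d C)) (+ suc (2 ℕ.^ n))
  where
  lemma : ∀ p q r s m → (+ 2 * p - m) + (+ 2 * q - m) + (+ 2 * r - m) + (+ 2 * s - m)
                      ≡ + 2 * (p + q + r + s) - + 4 * m
  lemma = solve-∀

total≡0⇒MagicFaced : (A : Labeling n) {G : SimpleGraph (Vertex n)} →
  ((C : FourCycle G) → total (deviation A) C ≡ 0ℤ) → MagicFaced G A
total≡0⇒MagicFaced {n} A {G} zero-sum C D = +-injective
  (cancel (+ cycleSum A C) (+ cycleSum A D) (+ 4 * + suc (2 ℕ.^ n)) (begin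
    + 2 * + cycleSum A C - + 4 * + suc (2 ℕ.^ n) ≡⟨ total-deviation A C ⟨
    total (deviation A) C                        ≡⟨ trans (zero-sum C) (sym (zero-sum D)) ⟩
    total (deviation A) D                        ≡⟨ total-deviation A D ⟩
    + 2 * + cycleSum A D - + 4 * + suc (2 ℕ.^ n) ∎))
  where
  cancel : ∀ p q r → + 2 * p - r ≡ + 2 * q - r → p ≡ q
  cancel p q r e = *-cancelˡ-≡ (+ 2) p q (∙-cancelʳ (- r) (+ 2 * p) (+ 2 * q) e)

-- The vertex with the complementary label 2ⁿ + 1 - L; this pairing realises the symmetry of the
-- values of `deviation A` about 0.
mirror : Labeling n → Vertex n → Vertex n
mirror A = Inverse.from (⤖⇒↔ A) ∘ opposite ∘ Bijection.to A

to-mirror : (A : Labeling n) (x : Vertex n) →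
  Bijection.to A (mirror A x) ≡ opposite (Bijection.to A x)
to-mirror A x = Inverse.strictlyInverseˡ (⤖⇒↔ A) _

mirror-involutive : (A : Labeling n) → Involutive _≡_ (mirror A)
mirror-involutive A x = trans
  (cong (Inverse.from (⤖⇒↔ A)) (trans (cong opposite (to-mirror A x)) (opposite-involutive _)))
  (Inverse.strictlyInverseʳ (⤖⇒↔ A) x)

deviation-mirror : (A : Labeling n) (x : Vertex n) → deviation A (mirror A x) ≡ - deviation A x
deviation-mirror A x
  rewrite to-mirror A x | opposite-involutive (Bijection.to A x) =
  lemma (+ toℕ (Bijection.to A x)) (+ toℕ (opposite (Bijection.to A x)))
  where
  lemma : ∀ p q → q - p ≡ - (p - q)
  lemma = solve-∀

-- All faces share one total `T`. The 2ⁿ⁻² parallel faces in the first two directions partition the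
-- vertices, so `T` times their number is the sum of `deviation A` over the cube, which vanishes by
-- `mirror`.
deviation-balanced : (A : Labeling n) → 2 ℕ.≤ n → MagicFaced (Q n) A →
  (C : FourCycle (Q n)) → total (deviation A) C ≡ 0ℤ
deviation-balanced {n = suc zero} A (ℕ.s≤s ()) magic C
deviation-balanced {n = suc (suc m)} A _ magic C = trans (all-equal C) T≡0
  where
  f = deviation A
  0≢1 : _≢_ {A = Fin (suc (suc m))} zero (suc zero)
  0≢1 ()
  C₀ : FourCycle (Q (suc (suc m)))
  C₀ = face 0≢1 (replicate _ false)
  T : ℤ
  T = total f C₀
  all-equal : ∀ C → total f C ≡ T
  all-equal C = trans (total-deviation A C) (trans
    (cong (λ s → + 2 * + s - + 4 * + suc (2 ℕ.^ suc (suc m))) (magic C C₀))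
    (sym (total-deviation A C₀)))
  lemma : ∀ p q r s → p + r + s + q ≡ p + q + (r + s)
  lemma = solve-∀
  T≡0 : T ≡ 0ℤ
  T≡0 = ∑-const≡0 m (begin
    ∑ {m} (const T)
      ≡⟨ ∑-cong {m} (λ x → trans (sym (all-equal (face 0≢1 (false ∷ false ∷ x))))
                             (lemma (f _) (f _) (f _) (f _))) ⟩
    ∑ {m} (λ x → f (false ∷ false ∷ x) + f (false ∷ true ∷ x)
               + (f (true ∷ false ∷ x) + f (true ∷ true ∷ x)))
      -- `∑ f` unfolds to four sums over the last `m` coordinates, one for each corner of these
      -- faces.
      ≡⟨ trans (cong₂ _+_ (∑-+ {m} _ _) (∑-+ {m} _ _)) (∑-+ {m} _ _) ⟨
    ∑ f
      ≡⟨ ∑-antisymmetric (mirror-involutive A) (deviation-mirror A) ⟩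
    0ℤ ∎)

-- Zero totals on the folded and hierarchical folded cubes

FQ-total : (f : Vertex n → ℤ) → ((C : FourCycle (Q n)) → total f C ≡ 0ℤ) → 2 ∣ n →
  (C : FourCycle (FQ n)) → total f C ≡ 0ℤ
FQ-total {n} f Q-total 2∣n =
  addEdges-total _ complement complement-involutive sgn-τ R⇒τ f Q-total λ i →
  reflected-pair-sum f complement (λ i k i≢k x → Q-total (face i≢k x)) sgn-τ i (complement-flip i)
    -- `complement` reverses every coordinate, so no flat direction has to be invoked.
    (inj₁ (lookup-map i not))
  where
  sgn-τ : (x : Vertex n) → sgn (complement x) ≡ sgn x
  sgn-τ x = trans (sgn-complement x) (trans (cong (_* sgn x) (-1^even n 2∣n)) (*-identityˡ (sgn x)))
  R⇒τ : {x y : Vertex n} → Antipodal x y → y ≡ complement x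
  R⇒τ {x} opp = vertex-ext λ i → trans (¬-not (opp i ∘ sym)) (sym (lookup-map i not x))

-- The antipodal map of a layer reverses the n - 1 coordinates other than `j`, an even number, so it
-- keeps parity. In direction `j`, which it fixes, the flatness of `twist f` takes over.
HFQ-total : (f : Vertex n → ℤ) → ((C : FourCycle (Q n)) → total f C ≡ 0ℤ) → 2 ∤ n →
  (j : Fin n) → (∀ x → twist f (flip j x) ≡ twist f x) →
  (C : FourCycle (HFQ n j)) → total f C ≡ 0ℤ
HFQ-total {n} f Q-total 2∤n j flat = addEdges-total _ τ τ-involutive sgn-τ R⇒τ f Q-total λ i →
  reflected-pair-sum f τ (λ i k i≢k x → Q-total (face i≢k x)) sgn-τ i (τ-flip i) (opposite-or-flat i)
  where
  τ : Vertex n → Vertex n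
  τ x = flip j (complement x)
  τ-flip : ∀ i x → τ (flip i x) ≡ flip i (τ x)
  τ-flip i x = trans (cong (flip j) (complement-flip i x)) (flip-comm j i (complement x))
  τ-involutive : Involutive _≡_ τ
  τ-involutive x = trans (τ-flip j (complement x))
    (trans (flip-involutive j _) (complement-involutive x))
  sgn-τ : ∀ x → sgn (τ x) ≡ sgn x
  sgn-τ x = trans (sgn-flip j (complement x)) (trans (cong -_ (trans (sgn-complement x)
    (cong (_* sgn x) (-1^odd n 2∤n)))) (lemma (sgn x)))
    where
    lemma : ∀ s → - (-1ℤ * s) ≡ s
    lemma = solve-∀
  lookup-τ : ∀ {i} → i ≢ j → ∀ x → lookup (τ x) i ≡ not (lookup x i)
  lookup-τ {i} i≢j x = trans (lookup∘updateAt′ i j i≢j (complement x)) (lookup-map i not x)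
  opposite-or-flat : ∀ i → (∀ x → lookup (τ x) i ≡ not (lookup x i))
                         ⊎ (∀ x → twist f (flip i x) ≡ twist f x)
  opposite-or-flat i with i ≟ᶠ j
  ... | yes refl = inj₂ flat
  ... | no i≢j   = inj₁ (lookup-τ i≢j)
  R⇒τ : {x y : Vertex n} → AntipodalInLayer j x y → y ≡ τ x
  R⇒τ {x} {y} (same , opp) = vertex-ext agree
    where
    agree : ∀ i → lookup y i ≡ lookup (τ x) i
    agree i with i ≟ᶠ j
    ... | no i≢j   = trans (¬-not (opp i i≢j ∘ sym)) (sym (lookup-τ i≢j x))
    ... | yes refl = sym (trans (lookup∘updateAt i (complement x))
                       (trans (cong not (lookup-map i not x)) (trans (not-involutive _) same)))

-- `flat-direction` is applied to the n-th power, with leading coefficient 1. For odd n the signed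
-- sum of the n-th powers of `h` is the plain sum of those of `f`, and these cancel in pairs under
-- `mirror`.
deviation-flat : (A : Labeling n) → ((C : FourCycle (Q n)) → total (deviation A) C ≡ 0ℤ) → 2 ∤ n →
  ∃[ j ] ∀ x → twist (deviation A) (flip j x) ≡ twist (deviation A) x
deviation-flat {n} A Q-total 2∤n =
  flat-direction n (Lead-^ n) (λ ()) (twist-affine f (λ i k i≢k x → Q-total (face i≢k x)))
    (trans (∑-cong λ x → trans (sym (twist-^-odd 2∤n h x)) (cong (_^ n) (twist-involutive f x)))
      (∑-antisymmetric (mirror-involutive A) λ x →
        trans (cong (_^ n) (deviation-mirror A x)) (neg-^-odd 2∤n (f x))))
  where
  f = deviation A
  h = twist f

FQ-magic : (A : Labeling n) → MagicFaced (Q n) A → 2 ∣ n → MagicFaced (FQ n) A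
FQ-magic A magic 2∣n C = total≡0⇒MagicFaced A (FQ-total (deviation A) Q-total 2∣n) C
  where
  -- The cycle `C` at hand forces dimension at least 2; in dimension 0 there is none to check.
  Q-total = deviation-balanced A (FourCycle⇒2≤n C) magic

HFQ-magic : (A : Labeling n) → 2 ℕ.≤ n → MagicFaced (Q n) A → 2 ∤ n →
  ∃[ j ] MagicFaced (HFQ n j) A
HFQ-magic {n} A 2≤n magic 2∤n = go (deviation-flat A Q-total 2∤n)
  where
  Q-total = deviation-balanced A 2≤n magic
  go : (∃[ j ] ∀ x → twist (deviation A) (flip j x) ≡ twist (deviation A) x) →
    ∃[ j ] MagicFaced (HFQ n j) A
  go (j , flat) = j , total≡0⇒MagicFaced A (HFQ-total (deviation A) Q-total 2∤n j flat)

theorem2 : (n : ℕ) (A : Labeling n) → MagicFaced (Q n) A →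
    (2 ∣ n → MagicFaced (FQ n) A) × (2 ∤ n → ∃[ j ] MagicFaced (HFQ n j) A)
theorem2 n A magic = FQ-magic {n} A magic , odd n A magic
  where
  odd : ∀ n (A : Labeling n) → MagicFaced (Q n) A → 2 ∤ n → ∃[ j ] MagicFaced (HFQ n j) A
  odd zero          A magic 2∤n = contradiction (2 ∣0) 2∤n
  -- The only direction works vacuously, since two vertices carry no 4-cycle.
  odd (suc zero)    A magic 2∤n = zero , λ C → ⊥-elim (ℕ.1+n≰n (FourCycle⇒2≤n {1} C))
  odd (suc (suc m)) A magic 2∤n = HFQ-magic {suc (suc m)} A (ℕ.s≤s (ℕ.s≤s ℕ.z≤n)) magic 2∤n
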